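{- Let $\mathbb{P}$ be a logic program, let $G=[A_1,\dots,A_k]\in\mathcal{L}At(n)$ be a goal and let $\theta$ be a substitution with source $n$. The following are equivalent. 1. The saturated $\vee$-tree for $G$ in $\mathbb{P}$ has a refutation subtree with answer $\theta$. 2. There is an SLD-refutation for $G$ in $\mathbb{P}$ with correct answer $\theta$.
   Context: Fix a signature $\Sigma$ and predicate symbols with arities. Substitutions: an arrow $\theta:n\to m$ ($n,m$ natural numbers) is an $n$-tuple of $\Sigma$-terms with variables among $x_1,\dots,x_m$; $id_n=\langle x_1,\dots,x_n\rangle$; $\sigma\circ\theta$ is obtained by applying $\sigma$ to the terms of $\theta$. These form a category $\mathbf{L}=\mathbf{L}_\Sigma^{op}$ (opposite Lawvere theory). $At(n)$ is the set of atoms with variables among $x_1,\dots,x_n$; for $\theta:n\to m$ and $A\in At(n)$, $A\theta\in At(m)$ is the result of substituting. $\mathcal{L}At(n)$ is the set of finite lists over $At(n)$. A logic program is a finite set of clauses $H\leftarrow B_1,\dots,B_j$ ($j\ge0$); a clause $C$ has its variables among $x_1,\dots,x_{n_C}$, $n_C$ least. A unifier of $A'\in At(n')$ and the head $H$ of $C$ is a pair $\langle\sigma,\tau\rangle$, $\sigma:n'\to m'$, $\tau:n_C\to m'$, with $A'\sigma=H\tau$ (goal and clause variables are treated as disjoint); it is most general if it is a pushout in $\mathbf{L}$ of the argument tuples of $A'$ and $H$ (viewed as arrows $r\to n'$ and $r\to n_C$, $r$ the arity of the common predicate). Saturated $\vee$-tree for $l\in\mathcal{L}At(n)$ in $\mathbb{P}$: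 the possibly infinite tree whose nodes are labeled with lists of atoms, each in $\mathcal{L}At(m)$ for some $m$, whose root is labeled $l$, and whose edges are labeled with substitutions (an edge from a node with label in $\mathcal{L}At(m)$ to a child with label in $\mathcal{L}At(z)$ is labeled by some $\sigma:m\to z$), such that for every node $s$ with label $[A_1,\dots,A_k]\in\mathcal{L}At(m)$: for all substitutions $\sigma,\tau_1,\dots,\tau_k$ and lists $[C_1,\dots,C_k]$ of clauses of $\mathbb{P}$ such that, for each $C_i=H^i\leftarrow B^i_1,\dots,B^i_{j_i}$, $\langle\sigma,\tau_i\rangle$ is a unifier of $A_i$ and $H^i$, $s$ has exactly one child $t$, and conversely every child arises in this way; the edge from $s$ to $t$ is labeled $\sigma$ and $t$ is labeled with the concatenation $l_1::\dots::l_k$, where $l_i=[B^i_1\tau_i,\dots,B^i_{j_i}\tau_i]$. (In particular, for the empty list, every $\sigma:m\to z$ gives a child labeled with the empty list.) A refutation subtree of a saturated $\vee$-tree is a finite sequence of nodes $s_1,\dots,s_r$ where $s_1$ is the root, $s_{i+1}$ is a child of $s_i$, and $s_r$ is labeled with the empty list. Its answer is $\theta_{r-1}\circ\dots\circ\theta_2\circ\theta_1$, where $\theta_i$ labels the edge between $s_i$ and $s_{i+1}$ (the identity if $r=1$). SLD-resolution: starting from the goal $G_0=G$ (a finite collection of atoms over $x_1,\dots,x_n$), at step $i$ one selects an atom $A_i$ in the current goal $G_i$ and a clause $H\leftarrow B_1,\dots,B_j$ whose head unifies with $A_i$, with most general unifier $\langle\sigma_i,\tau_i\rangle$; the next goal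 $G_{i+1}$ consists of $B_1\tau_i,\dots,B_j\tau_i$ together with the atoms of $G_i$ other than $A_i$, instantiated by $\sigma_i$. An SLD-refutation is such a computation reaching the empty goal in finitely many steps; its computed answer is the composite of the $\sigma_i$'s (first $\sigma_0$, then $\sigma_1$, and so on). A correct answer is a substitution of the form $\sigma\circ\tau$ with $\tau$ a computed answer and $\sigma$ a substitution. -}

module Defs where

open import Data.Nat.Base using (ℕ; _≤_; _<_)
open import Data.Fin.Base using (Fin; toℕ)
open import Data.List.Base as List using (List; []; _++_; length; removeAt)
open import Data.List.Relation.Unary.All using (All; []; _∷_)
open import Data.List.Relation.Unary.Any as ListAny using ()
open import Data.List.Relation.Unary.Unique.Propositional using (Unique)
open import Data.Product.Base using (Σ-syntax; ∃-syntax; _×_)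
open import Data.Product using (∃!)
open import Data.Sum.Base using (_⊎_)
open import Data.Vec.Base as Vec using (Vec; []; _∷_; allFin)
open import Data.Vec.Relation.Unary.Any as VecAny using ()
open import Relation.Binary.PropositionalEquality.Core using (_≡_)

record Vocabulary : Set₁ where
  field
    Op        : Set
    opArity   : Op → ℕ
    Pred      : Set
    predArity : Pred → ℕ

module LogicProgramming (𝒱 : Vocabulary) where
  open Vocabulary 𝒱

  -- The variables x₁, …, xₙ are the elements of Fin n, so xᵢ is the element
  -- whose toℕ is i ∸ 1.
  data Term (n : ℕ) : Set where
    var : Fin n → Term n
    op  : (f : Op) → Vec (Term n) (opArity f) → Term n

  -- Arrows n → m of the category L.
  Subst : ℕ → ℕ → Set
  Subst n m = Vec (Term m) n

  idˢ : ∀ {n} → Subst n n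
  idˢ = Vec.map var (allFin _)

  infixl 8 _[_] _[_]ᵃ
  infixr 9 _∘_

  mutual
    _[_] : ∀ {n m} → Term n → Subst n m → Term m
    var x   [ σ ] = Vec.lookup σ x
    op f ts [ σ ] = op f (σ ∘ ts)

    _∘_ : ∀ {n m l} → Subst m l → Subst n m → Subst n l
    σ ∘ []       = []
    σ ∘ (t ∷ ts) = t [ σ ] ∷ (σ ∘ ts)

  -- i₁ : a → p and i₂ : b → p form a pushout in L of f : r → a and g : r → b.
  record IsPushout {r a b p} (f : Subst r a) (g : Subst r b)
                   (i₁ : Subst a p) (i₂ : Subst b p) : Set where
    field
      commutes  : i₁ ∘ f ≡ i₂ ∘ g
      universal : ∀ {z} (h₁ : Subst a z) (h₂ : Subst b z) → h₁ ∘ f ≡ h₂ ∘ g →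
                  ∃! _≡_ λ (u : Subst p z) → u ∘ i₁ ≡ h₁ × u ∘ i₂ ≡ h₂

  record Atom (n : ℕ) : Set where
    constructor atom
    field
      pred : Pred
      args : Vec (Term n) (predArity pred)

  _[_]ᵃ : ∀ {n m} → Atom n → Subst n m → Atom m
  atom p ts [ σ ]ᵃ = atom p (σ ∘ ts)

  _[_]ˡ : ∀ {n m} → List (Atom n) → Subst n m → List (Atom m)
  As [ σ ]ˡ = List.map _[ σ ]ᵃ As

  data _∈ᵗ_ {n} (x : Fin n) : Term n → Set where
    here  : x ∈ᵗ var x
    there : ∀ {f ts} → VecAny.Any (x ∈ᵗ_) ts → x ∈ᵗ op f ts

  _∈ᵃ_ : ∀ {n} → Fin n → Atom n → Set
  x ∈ᵃ A = VecAny.Any (x ∈ᵗ_) (Atom.args A)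

  record Clause : Set where
    field
      size   : ℕ
      head   : Atom size
      body   : List (Atom size)
      -- size is the least m such that all variables are among x₁, …, xₘ.
      -- Irrelevant, so that clauses are equal as soon as their heads and
      -- bodies are.
      .least : ∀ m →
               (∀ x → x ∈ᵃ head ⊎ ListAny.Any (x ∈ᵃ_) body → toℕ x < m) →
               size ≤ m

  record Program : Set where
    field
      clauses  : List Clause
      distinct : Unique clauses

  -- The goal atom A and the clause head H live over separate variable sets,
  -- hence the two components.
  IsUnifier : ∀ {n c m} → Atom n → Atom c → Subst n m → Subst c m → Set
  IsUnifier A H σ τ = A [ σ ]ᵃ ≡ H [ τ ]ᵃ

  data IsMostGeneralUnifier {n c m} : Atom n → Atom c →
                                      Subst n m → Subst c m → Set where
    pushout : ∀ {p s t σ τ} → IsPushout s t σ τ →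
              IsMostGeneralUnifier (atom p s) (atom p t) σ τ

  module _ (ℙ : Program) where
    open Program ℙ

    ClauseIndex : Set
    ClauseIndex = Fin (length clauses)

    clause : ClauseIndex → Clause
    clause = List.lookup clauses

    record Resolver {m z} (σ : Subst m z) (A : Atom m) : Set where
      field
        index : ClauseIndex
      open Clause (clause index) public
      field
        τ       : Subst size z
        unifies : IsUnifier A head σ τ

      instantiatedBody : List (Atom z)
      instantiatedBody = body [ τ ]ˡ

    -- The data σ, [C₁, …, C_k], τ₁, …, τ_k determining one child of a node
    -- labelled l.
    record Expansion {m} (l : List (Atom m)) (z : ℕ) : Set where
      field
        σ         : Subst m z
        resolvers : All (Resolver σ) l

    concatBodies : ∀ {m z} {σ : Subst m z} {l : List (Atom m)} →
                   All (Resolver σ) l → List (Atom z)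
    concatBodies []       = []
    concatBodies (r ∷ rs) = Resolver.instantiatedBody r ++ concatBodies rs

    -- The saturated ∨-tree for G, given by its nodes: Node G m consists of the
    -- nodes whose label lies in ℒAt(m). A node s has exactly one child for
    -- each expansion of its label; infinite branching and infinite depth are
    -- both possible although each node is at finite depth.
    mutual
      data Node {n} (G : List (Atom n)) : ℕ → Set where
        root  : Node G n
        child : ∀ {m z} (s : Node G m) → Expansion (label s) z → Node G z

      label : ∀ {n m} {G : List (Atom n)} → Node G m → List (Atom m)
      label {G = G} root = G
      label (child s e)  = concatBodies (Expansion.resolvers e)

    edgeLabel : ∀ {n m z} {G : List (Atom n)} (s : Node G m) →
                Expansion (label s) z → Subst m z
    edgeLabel s e = Expansion.σ e

    -- Finite sequences of nodes starting at s, each a child of the previous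
    -- one, the last one in Node G z and labelled with the empty list.
    data RefutationFrom {n} {G : List (Atom n)} {m} (s : Node G m) : ℕ → Set where
      stop : label s ≡ [] → RefutationFrom s m
      next : ∀ {k z} (e : Expansion (label s) k) →
             RefutationFrom (child s e) z → RefutationFrom s z

    RefutationSubtree : ∀ {n} → List (Atom n) → ℕ → Set
    RefutationSubtree G z = RefutationFrom (root {G = G}) z

    answer : ∀ {n m z} {G : List (Atom n)} {s : Node G m} →
             RefutationFrom s z → Subst m z
    answer         (stop _)   = idˢ
    answer {s = s} (next e R) = answer R ∘ edgeLabel s e

    -- SLD-refutations whose final (empty) goal is over x₁, …, x_z. Goals are
    -- finite collections: their order is immaterial because any atom can be
    -- selected.
    data SLDRefutation : ∀ {n} → List (Atom n) → ℕ → Set where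
      empty   : ∀ {n} → SLDRefutation {n} [] n
      resolve : ∀ {n m z} {G : List (Atom n)}
                (selected : Fin (length G)) (c : ClauseIndex) →
                let open Clause (clause c) in
                (σ : Subst n m) (τ : Subst size m) →
                IsMostGeneralUnifier (List.lookup G selected) head σ τ →
                SLDRefutation (body [ τ ]ˡ ++ removeAt G selected [ σ ]ˡ) z →
                SLDRefutation G z

    computedAnswer : ∀ {n z} {G : List (Atom n)} → SLDRefutation G z → Subst n z
    computedAnswer empty               = idˢ
    computedAnswer (resolve _ _ σ _ _ R) = computedAnswer R ∘ σ

    HasRefutationSubtreeWithAnswer : ∀ {n m} → List (Atom n) → Subst n m → Set
    HasRefutationSubtreeWithAnswer {m = m} G θ =
      Σ[ R ∈ RefutationSubtree G m ] answer R ≡ θ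

    HasSLDRefutationWithCorrectAnswer : ∀ {n m} → List (Atom n) → Subst n m → Set
    HasSLDRefutationWithCorrectAnswer {m = m} G θ =
      ∃[ z ] Σ[ R ∈ SLDRefutation G z ] Σ[ σ ∈ Subst z m ]
        θ ≡ σ ∘ computedAnswer R

{-# OPTIONS --safe #-}

-- Both conditions say that every atom of Gθ has a finite proof tree whose
-- nodes are clause instances. From proof trees, a refutation subtree is
-- obtained by taking its first edge to be θ and all later ones identities, so
-- that each further node strips one level off the trees. An SLD-refutation is
-- obtained by traversing the trees depth first and replacing each clause
-- instance by a most general unifier, through which θ keeps factoring. Since θ
-- already provides a unifier, that most general unifier can be computed by
-- recursion on the common instance of the two terms: no decidable equality of
-- the function symbols is needed, and the occurs check reduces to comparing
-- sizes of instances.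
module Submission where

open import Defs
open import Data.Empty using (⊥-elim)
open import Data.Fin.Base using (Fin; zero; suc; punchOut)
open import Data.Fin.Properties using (_≟_)
open import Data.List.Base as List using (List; []; _∷_; _++_; removeAt)
open import Data.List.Properties as List using ()
open import Data.List.Relation.Unary.All as All using (All; []; _∷_)
open import Data.List.Relation.Unary.All.Properties as All using ()
open import Data.Nat.Base using (ℕ; zero; suc; _+_; _<_)
open import Data.Nat.Properties as ℕ using ()
open import Data.Product.Base using (Σ-syntax; ∃-syntax; _×_; _,_; proj₁; proj₂)
open import Data.Product using (∃!)
open import Data.Vec.Base as Vec using (Vec; []; _∷_; take; drop)
open import Data.Vec.Properties as Vec using ()
open import Function.Bundles using (_⇔_; mk⇔)
open import Relation.Binary.PropositionalEquality
  using (_≡_; _≢_; refl; sym; trans; cong; cong₂; subst; module ≡-Reasoning)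
open import Relation.Nullary using (yes; no)

-- Category laws for substitutions and their action on terms and atoms.

module Substitution (𝒱 : Vocabulary) where
  open Vocabulary 𝒱
  open LogicProgramming 𝒱

  ∘-map : ∀ {n m l} (σ : Subst m l) (θ : Subst n m) → σ ∘ θ ≡ Vec.map _[ σ ] θ
  ∘-map σ []      = refl
  ∘-map σ (t ∷ θ) = cong (t [ σ ] ∷_) (∘-map σ θ)

  lookup-∘ : ∀ {n m l} (σ : Subst m l) (θ : Subst n m) x →
             Vec.lookup (σ ∘ θ) x ≡ Vec.lookup θ x [ σ ]
  lookup-∘ σ θ x rewrite ∘-map σ θ = Vec.lookup-map x _[ σ ] θ

  ∘-idʳ : ∀ {n m} (σ : Subst n m) → σ ∘ idˢ ≡ σ
  ∘-idʳ σ = begin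
    σ ∘ idˢ                               ≡⟨ ∘-map σ idˢ ⟩
    Vec.map _[ σ ] idˢ                    ≡⟨ Vec.map-∘ _[ σ ] var (Vec.allFin _) ⟨
    Vec.map (Vec.lookup σ) (Vec.allFin _) ≡⟨ Vec.map-lookup-allFin σ ⟩
    σ                                     ∎
    where open ≡-Reasoning

  mutual
    [id] : ∀ {n} (t : Term n) → t [ idˢ ] ≡ t
    [id] (var x)   = trans (Vec.lookup-map x var (Vec.allFin _))
                           (cong var (Vec.lookup-allFin x))
    [id] (op f ts) = cong (op f) (∘-idˡ ts)

    ∘-idˡ : ∀ {n m} (σ : Subst n m) → idˢ ∘ σ ≡ σ
    ∘-idˡ []      = refl
    ∘-idˡ (t ∷ σ) = cong₂ _∷_ ([id] t) (∘-idˡ σ)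

  mutual
    [∘] : ∀ {n m l} (t : Term n) {σ : Subst m l} {θ : Subst n m} →
          t [ θ ] [ σ ] ≡ t [ σ ∘ θ ]
    [∘] (var x) {σ} {θ} = sym (lookup-∘ σ θ x)
    [∘] (op f ts)       = cong (op f) (sym (∘-assoc ts))

    ∘-assoc : ∀ {k n m l} (ρ : Subst k n) {σ : Subst m l} {θ : Subst n m} →
              (σ ∘ θ) ∘ ρ ≡ σ ∘ (θ ∘ ρ)
    ∘-assoc []      = refl
    ∘-assoc (t ∷ ρ) = cong₂ _∷_ (sym ([∘] t)) (∘-assoc ρ)

  [id]ᵃ : ∀ {n} (A : Atom n) → A [ idˢ ]ᵃ ≡ A
  [id]ᵃ (atom p ts) = cong (atom p) (∘-idˡ ts)

  [∘]ᵃ : ∀ {n m l} (A : Atom n) {σ : Subst m l} {θ : Subst n m} →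
         A [ θ ]ᵃ [ σ ]ᵃ ≡ A [ σ ∘ θ ]ᵃ
  [∘]ᵃ (atom p ts) = cong (atom p) (sym (∘-assoc ts))

  [∘]ˡ : ∀ {n m l} (As : List (Atom n)) {σ : Subst m l} {θ : Subst n m} →
         As [ θ ]ˡ [ σ ]ˡ ≡ As [ σ ∘ θ ]ˡ
  [∘]ˡ As = trans (sym (List.map-∘ As)) (List.map-cong (λ A → [∘]ᵃ A) As)

  removeAt-∘ : ∀ {n m l} (σ : Subst m l) (θ : Subst (suc n) m) x →
               σ ∘ Vec.removeAt θ x ≡ Vec.removeAt (σ ∘ θ) x
  removeAt-∘ σ (t ∷ θ)           zero    = refl
  removeAt-∘ σ (t ∷ θ@(_ ∷ _)) (suc x) = cong (t [ σ ] ∷_) (removeAt-∘ σ θ x)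

  insertAt-∘ : ∀ {n m l} (σ : Subst m l) (θ : Subst n m) x t →
               σ ∘ Vec.insertAt θ x t ≡ Vec.insertAt (σ ∘ θ) x (t [ σ ])
  insertAt-∘ σ θ x t = begin
    σ ∘ Vec.insertAt θ x t                       ≡⟨ ∘-map σ _ ⟩
    Vec.map _[ σ ] (Vec.insertAt θ x t)          ≡⟨ Vec.map-insertAt _[ σ ] t θ x ⟩
    Vec.insertAt (Vec.map _[ σ ] θ) x (t [ σ ])  ≡⟨ cong (λ ρ → Vec.insertAt ρ x _) (∘-map σ θ) ⟨
    Vec.insertAt (σ ∘ θ) x (t [ σ ])             ∎
    where open ≡-Reasoning

  take-∘ : ∀ n {c m l} (σ : Subst m l) (θ : Subst (n + c) m) →
           σ ∘ take n θ ≡ take n (σ ∘ θ)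
  take-∘ n σ θ = begin
    σ ∘ take n θ               ≡⟨ ∘-map σ _ ⟩
    Vec.map _[ σ ] (take n θ)  ≡⟨ Vec.take-map _[ σ ] n θ ⟨
    take n (Vec.map _[ σ ] θ)  ≡⟨ cong (take n) (∘-map σ θ) ⟨
    take n (σ ∘ θ)             ∎
    where open ≡-Reasoning

  drop-∘ : ∀ n {c m l} (σ : Subst m l) (θ : Subst (n + c) m) →
           σ ∘ drop n θ ≡ drop n (σ ∘ θ)
  drop-∘ n σ θ = begin
    σ ∘ drop n θ               ≡⟨ ∘-map σ _ ⟩
    Vec.map _[ σ ] (drop n θ)  ≡⟨ Vec.drop-map _[ σ ] n θ ⟨
    drop n (Vec.map _[ σ ] θ)  ≡⟨ cong (drop n) (∘-map σ θ) ⟨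
    drop n (σ ∘ θ)             ∎
    where open ≡-Reasoning

-- Most general unifiers, built from a given unifier.

module Unification (𝒱 : Vocabulary) where
  open Vocabulary 𝒱
  open LogicProgramming 𝒱
  open Substitution 𝒱

  Constraint : ℕ → Set₁
  Constraint n = ∀ {z} → Subst n z → Set

  -- For a constraint `us ≐ˢ vs` this is a coequalizer in the category of substitutions; the factor
  -- is unique because the pushout property asks for that.
  record MostGeneral {n} (E : Constraint n) : Set where
    field
      {target} : ℕ
      mgu      : Subst n target
      solves   : E mgu
      factor   : ∀ {z} (h : Subst n z) → E h → ∃! _≡_ λ u → u ∘ mgu ≡ h

  transfer : ∀ {n} {E E′ : Constraint n} →
             (∀ {z} {h : Subst n z} → E h → E′ h) →
             (∀ {z} {h : Subst n z} → E′ h → E h) →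
             MostGeneral E → MostGeneral E′
  transfer to from M = record
    { mgu    = mgu
    ; solves = to solves
    ; factor = λ h e → factor h (from e)
    } where open MostGeneral M

  infix 4 _≐_ _≐ˢ_

  _≐_ : ∀ {n} → Term n → Term n → Constraint n
  (u ≐ v) h = u [ h ] ≡ v [ h ]

  _≐ˢ_ : ∀ {r n} → Subst r n → Subst r n → Constraint n
  (us ≐ˢ vs) h = h ∘ us ≡ h ∘ vs

  unconstrained : ∀ {n} {E : Constraint n} → (∀ {z} (h : Subst n z) → E h) → MostGeneral E
  unconstrained e = record
    { mgu    = idˢ
    ; solves = e idˢ
    ; factor = λ h _ → h , ∘-idʳ h , λ {u} e → trans (sym e) (∘-idʳ u)
    }

  mutual
    size : ∀ {n} → Term n → ℕ
    size (var x)   = 1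
    size (op f ts) = suc (sizes ts)

    sizes : ∀ {r n} → Vec (Term n) r → ℕ
    sizes []       = 0
    sizes (t ∷ ts) = size t + sizes ts

  -- `Vec.removeAt idˢ x` is the renaming of `n` variables into `suc n` that skips `x`; the terms in
  -- its image are those in which `x` does not occur.
  strengthen-var : ∀ {n} {x y : Fin (suc n)} (x≢y : x ≢ y) →
                   var (punchOut x≢y) [ Vec.removeAt idˢ x ] ≡ var y
  strengthen-var {y = y} x≢y =
    trans (Vec.removeAt-punchOut idˢ x≢y) ([id] (var y))

  -- The occurs check: if x occurred in t, then the instance of t would be at
  -- least as large as that of x.
  mutual
    strengthen : ∀ {n z} (h : Subst (suc n) z) x (t : Term (suc n)) →
                 size (t [ h ]) < size (Vec.lookup h x) →
                 Σ[ t′ ∈ Term n ] t′ [ Vec.removeAt idˢ x ] ≡ t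
    strengthen h x (var y) lt with x ≟ y
    ... | yes refl = ⊥-elim (ℕ.<-irrefl refl lt)
    ... | no x≢y   = var (punchOut x≢y) , strengthen-var x≢y
    strengthen h x (op f ts) lt =
      let ts′ , e = strengthens h x ts (ℕ.<-trans (ℕ.n<1+n _) lt)
      in op f ts′ , cong (op f) e

    strengthens : ∀ {n z r} (h : Subst (suc n) z) x (ts : Vec (Term (suc n)) r) →
                  sizes (h ∘ ts) < size (Vec.lookup h x) →
                  Σ[ ts′ ∈ Vec (Term n) r ] Vec.removeAt idˢ x ∘ ts′ ≡ ts
    strengthens h x []       lt = [] , refl
    strengthens h x (t ∷ ts) lt =
      let t′  , e  = strengthen  h x t  (ℕ.≤-<-trans (ℕ.m≤m+n _ _) lt)
          ts′ , es = strengthens h x ts (ℕ.≤-<-trans (ℕ.m≤n+m _ (size (t [ h ]))) lt)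
      in t′ ∷ ts′ , cong₂ _∷_ e es

  -- The right-hand side avoids `x`, so putting `t` for `x` and renumbering the other variables
  -- solves the equation. A solution `h` factors by forgetting its value at `x`, which the equation
  -- determines.
  eliminate : ∀ {n} (x : Fin (suc n)) (t : Term n) →
              MostGeneral (var x ≐ t [ Vec.removeAt idˢ x ])
  eliminate x t = record
    { mgu    = q
    ; solves = begin
        Vec.lookup q x                  ≡⟨ Vec.insertAt-lookup idˢ x t ⟩
        t                               ≡⟨ [id] t ⟨
        t [ idˢ ]                       ≡⟨ cong (t [_]) (Vec.removeAt-insertAt idˢ x t) ⟨
        t [ Vec.removeAt q x ]          ≡⟨ restrict q ⟨
        t [ Vec.removeAt idˢ x ] [ q ]  ∎
    ; factor = λ h e → Vec.removeAt h x , factors h e , unique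
    }
    where
    open ≡-Reasoning
    q = Vec.insertAt idˢ x t

    restrict : ∀ {z} (h : Subst _ z) →
               t [ Vec.removeAt idˢ x ] [ h ] ≡ t [ Vec.removeAt h x ]
    restrict h = begin
      t [ Vec.removeAt idˢ x ] [ h ]   ≡⟨ [∘] t ⟩
      t [ h ∘ Vec.removeAt idˢ x ]     ≡⟨ cong (t [_]) (removeAt-∘ h idˢ x) ⟩
      t [ Vec.removeAt (h ∘ idˢ) x ]   ≡⟨ cong (λ ρ → t [ Vec.removeAt ρ x ]) (∘-idʳ h) ⟩
      t [ Vec.removeAt h x ]           ∎

    u∘q : ∀ {z} (u : Subst _ z) → u ∘ q ≡ Vec.insertAt u x (t [ u ])
    u∘q u = trans (insertAt-∘ u idˢ x t)
                  (cong (λ ρ → Vec.insertAt ρ x (t [ u ])) (∘-idʳ u))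

    factors : ∀ {z} (h : Subst _ z) → (var x ≐ t [ Vec.removeAt idˢ x ]) h →
              Vec.removeAt h x ∘ q ≡ h
    factors h e = begin
      Vec.removeAt h x ∘ q
        ≡⟨ u∘q (Vec.removeAt h x) ⟩
      Vec.insertAt (Vec.removeAt h x) x (t [ Vec.removeAt h x ])
        ≡⟨ cong (Vec.insertAt (Vec.removeAt h x) x) (trans e (restrict h)) ⟨
      Vec.insertAt (Vec.removeAt h x) x (Vec.lookup h x)
        ≡⟨ Vec.insertAt-removeAt h x ⟩
      h ∎

    unique : ∀ {z} {h : Subst _ z} {u} → u ∘ q ≡ h → Vec.removeAt h x ≡ u
    unique {u = u} refl =
      trans (cong (λ ρ → Vec.removeAt ρ x) (u∘q u)) (Vec.removeAt-insertAt u x (t [ u ]))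

  bind : ∀ {n} (x : Fin (suc n)) {t : Term (suc n)} →
         Σ[ t′ ∈ Term n ] t′ [ Vec.removeAt idˢ x ] ≡ t → MostGeneral (var x ≐ t)
  bind x (t′ , refl) = eliminate x t′

  -- Splitting off the equality of symbols lets it be matched with `refl` even when the argument
  -- tuples are not variables.
  op-injective : ∀ {n f g ts us} → op {n} f ts ≡ op g us →
                 Σ[ e ∈ f ≡ g ] subst (λ k → Vec (Term n) (opArity k)) e ts ≡ us
  op-injective refl = refl , refl

  op-injectiveʳ : ∀ {n f} {ts us : Vec (Term n) (opArity f)} → op f ts ≡ op f us → ts ≡ us
  op-injectiveʳ refl = refl

  bind-op : ∀ {n z} (h : Subst n z) x {f} (ts : Vec (Term n) (opArity f)) →
            (var x ≐ op f ts) h → MostGeneral (var x ≐ op f ts)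
  bind-op {suc _} h x {f} ts e =
    -- The instance of `x` is `op f` over the instances of `ts`, so its size is one more than
    -- theirs.
    let ts′ , es = strengthens h x ts (ℕ.≤-reflexive (cong size (sym e)))
    in bind x (op f ts′ , cong (op f) es)

  -- A common solution factors through `q`, and its factor solves the remaining equations
  -- instantiated by `q`, hence factors again. Uniqueness passes through the same two stages.
  compose : ∀ {r n} (u v : Term n) (us vs : Subst r n) (M : MostGeneral (u ≐ v)) →
            let q = MostGeneral.mgu M in
            MostGeneral (q ∘ us ≐ˢ q ∘ vs) → MostGeneral (u ∷ us ≐ˢ v ∷ vs)
  compose u v us vs M N = record
    { mgu    = N.mgu ∘ M.mgu
    ; solves = cong₂ _∷_
        (trans (sym ([∘] u)) (trans (cong _[ N.mgu ] M.solves) ([∘] v)))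
        (trans (∘-assoc us) (trans N.solves (sym (∘-assoc vs))))
    ; factor = factor
    }
    where
    module M = MostGeneral M
    module N = MostGeneral N
    factor : ∀ {z} (h : Subst _ z) → (u ∷ us ≐ˢ v ∷ vs) h →
             ∃! _≡_ λ k → k ∘ (N.mgu ∘ M.mgu) ≡ h
    factor h e with M.factor h (Vec.∷-injectiveˡ e)
    ... | h₁ , refl , h₁-unique with N.factor h₁ (trans (sym (∘-assoc us))
                                       (trans (Vec.∷-injectiveʳ e) (∘-assoc vs)))
    ... | h₂ , refl , h₂-unique =
      h₂ , sym (∘-assoc M.mgu) ,
      λ e → h₂-unique (sym (h₁-unique (trans (∘-assoc M.mgu) e)))

  -- The two sides meet in w, on which the recursion is: for a later equation
  -- the terms change by a substitution, but their common instance does not.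
  mutual
    unify : ∀ {n z} (h : Subst n z) (u v : Term n) (w : Term z) →
            u [ h ] ≡ w → v [ h ] ≡ w → MostGeneral (u ≐ v)
    unify {suc _} h (var x) (var y) w eu ev with x ≟ y
    ... | yes refl = unconstrained (λ _ → refl)
    ... | no x≢y   = bind x (var (punchOut x≢y) , strengthen-var x≢y)
    unify h (var x)   (op g vs) w eu ev = bind-op h x vs (trans eu (sym ev))
    unify h (op f us) (var y)   w eu ev =
      transfer sym sym (bind-op h y us (trans ev (sym eu)))
    -- Both head symbols equal `k`, so a clash cannot occur.
    unify h (op f us) (op g vs) (op k ws) eu ev
      with refl , eus ← op-injective eu | refl , evs ← op-injective ev =
      transfer (cong (op f)) op-injectiveʳ (unifies h us vs ws eus evs)

    unifies : ∀ {r n z} (h : Subst n z) (us vs : Subst r n) (ws : Vec (Term z) r) →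
              h ∘ us ≡ ws → h ∘ vs ≡ ws → MostGeneral (us ≐ˢ vs)
    unifies h []       []       []       eus evs = unconstrained (λ _ → refl)
    unifies h (u ∷ us) (v ∷ vs) (w ∷ ws) eus evs =
      let eu , eus′       = Vec.∷-injective eus
          ev , evs′       = Vec.∷-injective evs
          M               = unify h u v w eu ev
          q               = MostGeneral.mgu M
          -- The factor `h′` of `h` takes the remaining equations, instantiated by `q`, to the same
          -- `ws`.
          h′ , h′∘q≡h , _ = MostGeneral.factor M h (trans eu (sym ev))
          push            = λ ts → trans (sym (∘-assoc ts)) (cong (_∘ ts) h′∘q≡h)
          N               = unifies h′ (q ∘ us) (q ∘ vs) ws
                              (trans (push us) eus′) (trans (push vs) evs′)
      in compose u v us vs M N

  -- A pushout over n and c variables is a coequalizer over n + c variables.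
  pushout-exists : ∀ {r n c z} (s : Subst r n) (t : Subst r c)
                   (σ : Subst n z) (τ : Subst c z) → σ ∘ s ≡ τ ∘ t →
                   ∃[ m ] Σ[ σ′ ∈ Subst n m ] Σ[ τ′ ∈ Subst c m ] IsPushout s t σ′ τ′
  pushout-exists {n = n} {c} s t σ τ e =
    M.target , take n M.mgu , drop n M.mgu , record
      { commutes  = merge⁻ (sym (Vec.take++drop≡id n M.mgu)) M.solves
      ; universal = λ h₁ h₂ e →
          let u , u∘q≡h , u-unique = M.factor (h₁ Vec.++ h₂) (merge⁺ refl e)
              split = Vec.++-injective (take n (u ∘ M.mgu)) h₁
                        (trans (Vec.take++drop≡id n _) u∘q≡h)
          in u , ( trans (take-∘ n u M.mgu) (proj₁ split)
                 , trans (drop-∘ n u M.mgu) (proj₂ split)) ,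
             λ {u′} (e₁ , e₂) → u-unique
               (trans (sym (Vec.take++drop≡id n (u′ ∘ M.mgu)))
                 (cong₂ Vec._++_ (trans (sym (take-∘ n u′ M.mgu)) e₁)
                                 (trans (sym (drop-∘ n u′ M.mgu)) e₂)))
      }
    where
    -- `inˡ` and `inʳ` are the coproduct injections, with `Vec._++_` as copairing.
    inˡ : Subst n (n + c)
    inˡ = take n idˢ

    inʳ : Subst c (n + c)
    inʳ = drop n idˢ

    copair : ∀ {z} {h : Subst (n + c) z} (h₁ : Subst n z) (h₂ : Subst c z) →
             h ≡ h₁ Vec.++ h₂ → h ∘ inˡ ≡ h₁ × h ∘ inʳ ≡ h₂
    copair {h = h} h₁ h₂ e =
      let e₁ , e₂ = Vec.++-injective (take n h) h₁ (trans (Vec.take++drop≡id n h) e)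
      in trans (trans (take-∘ n h idˢ) (cong (take n) (∘-idʳ h))) e₁
       , trans (trans (drop-∘ n h idˢ) (cong (drop n) (∘-idʳ h))) e₂

    merge⁺ : ∀ {z} {h : Subst (n + c) z} {h₁ : Subst n z} {h₂ : Subst c z} →
             h ≡ h₁ Vec.++ h₂ → h₁ ∘ s ≡ h₂ ∘ t → (inˡ ∘ s ≐ˢ inʳ ∘ t) h
    merge⁺ {h₁ = h₁} {h₂} e e′ =
      let e₁ , e₂ = copair h₁ h₂ e
      in trans (trans (sym (∘-assoc s)) (cong (_∘ s) e₁))
           (trans e′ (sym (trans (sym (∘-assoc t)) (cong (_∘ t) e₂))))

    merge⁻ : ∀ {z} {h : Subst (n + c) z} {h₁ : Subst n z} {h₂ : Subst c z} →
             h ≡ h₁ Vec.++ h₂ → (inˡ ∘ s ≐ˢ inʳ ∘ t) h → h₁ ∘ s ≡ h₂ ∘ t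
    merge⁻ {h₁ = h₁} {h₂} e e′ =
      let e₁ , e₂ = copair h₁ h₂ e
      in trans (sym (trans (sym (∘-assoc s)) (cong (_∘ s) e₁)))
           (trans e′ (trans (sym (∘-assoc t)) (cong (_∘ t) e₂)))

    -- The copairing of `σ` and `τ` is the known solution from which `unifies` starts.
    module M = MostGeneral
      (unifies (σ Vec.++ τ) (inˡ ∘ s) (inʳ ∘ t) _ refl (sym (merge⁺ refl e)))

  atom-injective : ∀ {n p q ts us} → atom {n} p ts ≡ atom q us →
                   Σ[ e ∈ p ≡ q ] subst (λ k → Vec (Term n) (predArity k)) e ts ≡ us
  atom-injective refl = refl , refl

  -- The given unifier both yields the most general one and factors through it; `u` is the part of
  -- the answer left for later steps.
  mgu-exists : ∀ {n c z} (A : Atom n) (H : Atom c) {σ : Subst n z} {τ : Subst c z} →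
               IsUnifier A H σ τ →
               ∃[ m ] Σ[ σ′ ∈ Subst n m ] Σ[ τ′ ∈ Subst c m ]
                 IsMostGeneralUnifier A H σ′ τ′ ×
                 Σ[ u ∈ Subst m z ] u ∘ σ′ ≡ σ × u ∘ τ′ ≡ τ
  mgu-exists (atom p s) (atom q t) {σ} {τ} e with refl , e′ ← atom-injective e =
    let m , σ′ , τ′ , P    = pushout-exists s t σ τ e′
        u , (uσ′ , uτ′) , _ = IsPushout.universal P σ τ e′
    in m , σ′ , τ′ , pushout P , u , uσ′ , uτ′

module Correctness (𝒱 : Vocabulary) (ℙ : LogicProgramming.Program 𝒱) where
  open LogicProgramming 𝒱
  open Substitution 𝒱
  open Unification 𝒱

  -- Proof trees and their instances.

  module Cl (c : ClauseIndex ℙ) = Clause (clause ℙ c)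

  -- The premises are indexed by the uninstantiated body, so they can be matched on without
  -- inverting `_[ τ ]ˡ`.
  data Provable {z} : Atom z → Set where
    derive : ∀ {A} c (τ : Subst (Cl.size c) z) → A ≡ Cl.head c [ τ ]ᵃ →
             All (λ B → Provable (B [ τ ]ᵃ)) (Cl.body c) → Provable A

  Provable[_] : ∀ {n z} → Subst n z → Atom n → Set
  Provable[ θ ] A = Provable (A [ θ ]ᵃ)

  mutual
    -- Accounts for the passage from computed to correct answers: every node of the tree is
    -- instantiated by `σ`.
    _⟦_⟧ : ∀ {n z} {A : Atom n} → Provable A → (σ : Subst n z) → Provable (A [ σ ]ᵃ)
    derive c τ refl ps ⟦ σ ⟧ = derive c (σ ∘ τ) ([∘]ᵃ (Cl.head c)) (ps ⟦ σ ⟧ˢ)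

    _⟦_⟧ˢ : ∀ {k n z} {τ : Subst k n} {As : List (Atom k)} →
            All Provable[ τ ] As → (σ : Subst n z) → All Provable[ σ ∘ τ ] As
    []                    ⟦ σ ⟧ˢ = []
    _∷_ {x = A} p ps ⟦ σ ⟧ˢ = subst Provable ([∘]ᵃ A) (p ⟦ σ ⟧) ∷ ps ⟦ σ ⟧ˢ

  flatten : ∀ {k n z} {τ : Subst k n} {σ : Subst n z} (As : List (Atom k)) →
            All Provable[ σ ] (As [ τ ]ˡ) → All Provable[ σ ∘ τ ] As
  flatten As ps = All.map (λ {A} → subst Provable ([∘]ᵃ A)) (All.map⁻ ps)

  -- One resolution step read backwards, for both kinds of refutation: a unifier composed with `u`
  -- is still a unifier.
  provable-by : ∀ {n m z} (A : Atom n) c {σ : Subst n m} {τ : Subst (Cl.size c) m}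
                {u : Subst m z} → IsUnifier A (Cl.head c) σ τ →
                All Provable[ u ] (Cl.body c [ τ ]ˡ) → Provable[ u ∘ σ ] A
  provable-by A c {σ} {τ} {u} e ps =
    derive c (u ∘ τ)
      (trans (sym ([∘]ᵃ A)) (trans (cong _[ u ]ᵃ e) ([∘]ᵃ (Cl.head c))))
      (flatten (Cl.body c) ps)

  -- Refutation subtrees and proof trees.

  resolvers-provable : ∀ {n m z} {σ : Subst n m} {u : Subst m z} {As : List (Atom n)}
                       (rs : All (Resolver ℙ σ) As) →
                       All Provable[ u ] (concatBodies ℙ rs) → All Provable[ u ∘ σ ] As
  resolvers-provable []                ps = []
  resolvers-provable (_∷_ {x = A} r rs) ps =
    let ps₁ , ps₂ = All.++⁻ (Resolver.instantiatedBody r) ps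
    in provable-by A (Resolver.index r) (Resolver.unifies r) ps₁ ∷
       resolvers-provable rs ps₂

  refutation⇒provable : ∀ {n m z} {G : List (Atom n)} {s : Node ℙ G m}
                        (R : RefutationFrom ℙ s z) → All Provable[ answer ℙ R ] (label ℙ s)
  refutation⇒provable (stop e) rewrite e = []
  refutation⇒provable (next e R) =
    resolvers-provable (Expansion.resolvers e) (refutation⇒provable R)

  -- Refutations with only identity edges, indexed by labels instead of nodes: labels can be
  -- concatenated, nodes cannot.
  data Layers {z} : List (Atom z) → Set where
    done  : Layers []
    layer : ∀ {As} (rs : All (Resolver ℙ idˢ) As) → Layers (concatBodies ℙ rs) → Layers As

  concatBodies-++ : ∀ {n z} {σ : Subst n z} {As Bs : List (Atom n)}
                    (rs : All (Resolver ℙ σ) As) (qs : All (Resolver ℙ σ) Bs) →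
                    concatBodies ℙ rs ++ concatBodies ℙ qs ≡ concatBodies ℙ (All.++⁺ rs qs)
  concatBodies-++ []       qs = refl
  concatBodies-++ (r ∷ rs) qs =
    trans (List.++-assoc (Resolver.instantiatedBody r) _ _)
          (cong (Resolver.instantiatedBody r ++_) (concatBodies-++ rs qs))

  -- The two run in parallel, because a step expands all atoms of a label at once; when one is
  -- exhausted, the other goes on alone.
  _++ᴸ_ : ∀ {z} {As Bs : List (Atom z)} → Layers As → Layers Bs → Layers (As ++ Bs)
  done             ++ᴸ N          = N
  L@(layer _ _)    ++ᴸ done       = subst Layers (sym (List.++-identityʳ _)) L
  layer rs L       ++ᴸ layer qs N =
    layer (All.++⁺ rs qs) (subst Layers (concatBodies-++ rs qs) (L ++ᴸ N))

  mutual
    layers : ∀ {z} {A : Atom z} → Provable A → Layers (A ∷ [])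
    layers {A = A} (derive c τ e ps) =
      layer (record { index = c ; τ = τ ; unifies = trans ([id]ᵃ A) e } ∷ [])
            (subst Layers (sym (List.++-identityʳ _)) (layersˢ ps))

    layersˢ : ∀ {n z} {θ : Subst n z} {As : List (Atom n)} →
              All Provable[ θ ] As → Layers (As [ θ ]ˡ)
    layersˢ []       = done
    layersˢ (p ∷ ps) = layers p ++ᴸ layersˢ ps

  -- The list `As` and its equation keep the index of `Layers` a variable, so that `done` can be
  -- matched.
  layers⇒refutation : ∀ {n m} {G : List (Atom n)} (s : Node ℙ G m) {As} → As ≡ label ℙ s →
                      Layers As → Σ[ R ∈ RefutationFrom ℙ s m ] answer ℙ R ≡ idˢ
  layers⇒refutation s e    done         = stop (sym e) , refl
  layers⇒refutation s refl (layer rs L) =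
    let e     = record { σ = idˢ ; resolvers = rs }
        R , q = layers⇒refutation (child s e) refl L
    in next e R , trans (∘-idʳ (answer ℙ R)) q

  expand : ∀ {n z} {θ : Subst n z} {As : List (Atom n)} → All Provable[ θ ] As →
           Σ[ rs ∈ All (Resolver ℙ θ) As ] Layers (concatBodies ℙ rs)
  expand []                     = [] , done
  expand (derive c τ e ps ∷ qs) =
    let rs , L = expand qs
    in record { index = c ; τ = τ ; unifies = e } ∷ rs , layersˢ ps ++ᴸ L

  provable⇒refutation : ∀ {n z} (G : List (Atom n)) (θ : Subst n z) → All Provable[ θ ] G →
                        HasRefutationSubtreeWithAnswer ℙ G θ
  provable⇒refutation G θ ps =
    -- Even for the empty goal a first edge is taken: stopping at the root would give the answer
    -- `idˢ` instead of `θ`.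
    let rs , L = expand ps
        e      = record { σ = θ ; resolvers = rs }
        R , q  = layers⇒refutation (child root e) refl L
    in next e R , trans (cong (_∘ θ) q) (∘-idˡ θ)

  -- SLD-refutations and proof trees.

  removeAt⁻ : ∀ {A : Set} {P : A → Set} (xs : List A) i →
              P (List.lookup xs i) → All P (removeAt xs i) → All P xs
  removeAt⁻ (x ∷ xs) zero    p ps       = p ∷ ps
  removeAt⁻ (x ∷ xs) (suc i) p (q ∷ ps) = q ∷ removeAt⁻ xs i p ps

  mgu⇒unifier : ∀ {n c m} {A : Atom n} {H : Atom c} {σ : Subst n m} {τ : Subst c m} →
                IsMostGeneralUnifier A H σ τ → IsUnifier A H σ τ
  mgu⇒unifier (pushout P) = cong (atom _) (IsPushout.commutes P)

  sld⇒provable : ∀ {n z} {G : List (Atom n)} (R : SLDRefutation ℙ G z) →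
                 All Provable[ computedAnswer ℙ R ] G
  sld⇒provable empty = []
  sld⇒provable {G = G} (resolve i c σ τ mgu R) =
    let ps , qs = All.++⁻ (Cl.body c [ τ ]ˡ) (sld⇒provable R)
    in removeAt⁻ G i (provable-by (List.lookup G i) c (mgu⇒unifier mgu) ps)
                     (flatten (removeAt G i) qs)

  -- A depth-first traversal of proof trees, with the goal as a stack. Recursion on it is
  -- structural, whereas pushing premises onto a list of proof trees is not a structural descent.
  data Derivation {z} : List (Atom z) → Set where
    []   : Derivation []
    step : ∀ {A As} c (τ : Subst (Cl.size c) z) → A ≡ Cl.head c [ τ ]ᵃ →
           Derivation (Cl.body c [ τ ]ˡ ++ As) → Derivation (A ∷ As)

  mutual
    linearise : ∀ {z} {A : Atom z} {As} → Provable A → Derivation As → Derivation (A ∷ As)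
    linearise (derive c τ e ps) D = step c τ e (linearises ps D)

    linearises : ∀ {n z} {θ : Subst n z} {G : List (Atom n)} {As} →
                 All Provable[ θ ] G → Derivation As → Derivation (G [ θ ]ˡ ++ As)
    linearises []       D = D
    linearises (p ∷ ps) D = linearise p (linearises ps D)

  -- The lifting argument: `θ` and `τ` factor through the most general unifier by `u`, so the rest
  -- of the derivation proves the `u`-instance of the resolvent, and the induction applies with `u`
  -- as answer.
  derivation⇒sld : ∀ {n z} (G : List (Atom n)) (θ : Subst n z) {As} → As ≡ G [ θ ]ˡ →
                   Derivation As → HasSLDRefutationWithCorrectAnswer ℙ G θ
  -- The computed answer is `idˢ`, so `θ` itself is the instantiating substitution.
  derivation⇒sld []      θ refl []             = _ , empty , θ , sym (∘-idʳ θ)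
  derivation⇒sld (A ∷ G) θ refl (step c τ e D)
    with m , σ′ , τ′ , mgu , u , refl , refl ← mgu-exists A (Cl.head c) e =
    let z , R , ρ , u≡ρ∘R = derivation⇒sld (Cl.body c [ τ′ ]ˡ ++ G [ σ′ ]ˡ) u
                              (sym lifted) D
    in z , resolve zero c σ′ τ′ mgu R , ρ ,
       trans (cong (_∘ σ′) u≡ρ∘R) (∘-assoc σ′)
    where
    lifted : (Cl.body c [ τ′ ]ˡ ++ G [ σ′ ]ˡ) [ u ]ˡ ≡
             Cl.body c [ u ∘ τ′ ]ˡ ++ G [ u ∘ σ′ ]ˡ
    lifted = trans (List.map-++ _[ u ]ᵃ (Cl.body c [ τ′ ]ˡ) (G [ σ′ ]ˡ))
                   (cong₂ _++_ ([∘]ˡ (Cl.body c)) ([∘]ˡ G))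

  provable⇒sld : ∀ {n z} (G : List (Atom n)) (θ : Subst n z) → All Provable[ θ ] G →
                 HasSLDRefutationWithCorrectAnswer ℙ G θ
  provable⇒sld G θ ps =
    derivation⇒sld G θ (List.++-identityʳ _) (linearises ps [])

theorem10p10 : (𝒱 : Vocabulary) → let open LogicProgramming 𝒱 in
    (ℙ : Program) (n : ℕ) (G : List (Atom n)) (m : ℕ) (θ : Subst n m) →
    HasRefutationSubtreeWithAnswer ℙ G θ ⇔ HasSLDRefutationWithCorrectAnswer ℙ G θ
theorem10p10 𝒱 ℙ n G m θ = mk⇔
  (λ { (R , refl) → provable⇒sld G _ (refutation⇒provable R) })
  (λ { (z , R , σ , refl) → provable⇒refutation G _ (sld⇒provable R ⟦ σ ⟧ˢ) })
  where open Correctness 𝒱 ℙ
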